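{- Let $G$ be a graph (of arbitrary cardinality) which is a lexicographic sum, indexed by a finite graph, of graphs each of which is a clique or an independent set. Then every graph equimorphic to $G$ is isomorphic to $G$; that is, $G$ has exactly one sibling up to isomorphism.
   Context: Graphs are undirected and loopless. $G$ embeds into $G'$ if $G$ is isomorphic to an induced subgraph of $G'$; $G,G'$ are equimorphic if each embeds into the other. If $H$ is a graph on a vertex set $J$ and $(L_j)_{j\in J}$ are graphs, the lexicographic sum of the $L_j$ indexed by $H$ is the graph on the disjoint union of the vertex sets of the $L_j$ in which two vertices of the same $L_j$ are adjacent iff they are adjacent in $L_j$, and $x\in L_i$, $y\in L_j$ with $i\neq j$ are adjacent iff $\{i,j\}$ is an edge of $H$. The cliques and independent sets may be infinite. -}

module Defs where

open import Data.Fin.Base using (Fin)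
open import Data.Product.Base using (Σ; Σ-syntax; ∃-syntax; _×_; _,_)
open import Data.Refinement using (Refinement; value)
open import Data.Sum.Base using (_⊎_)
open import Function.Base using (_on_; _∘_)
open import Function.Bundles using (_↔_; _⇔_; Inverse)
open import Level using (Level; suc)
open import Relation.Binary.Core using (Rel)
open import Relation.Binary.Definitions using (Symmetric)
open import Relation.Binary.PropositionalEquality.Core using (_≢_; refl; sym)
open import Relation.Nullary.Negation.Core using (¬_)
open import Relation.Unary using (Pred)

private
  variable
    ℓ : Level

-- Adjacency proofs are not required to be unique: all notions below use
-- adjacency only up to logical equivalence, so there are no multi-edges.
record Graph (ℓ : Level) : Set (suc ℓ) where
  field
    Vertex    : Set ℓ
    Adj       : Rel Vertex ℓ
    symmetric : Symmetric Adj
    loopless  : ∀ x → ¬ Adj x x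

open Graph public

infix 4 _≅_

record _≅_ (G G′ : Graph ℓ) : Set ℓ where
  field
    bijection : Vertex G ↔ Vertex G′
    adjacency : ∀ x y →
      Adj G x y ⇔ Adj G′ (Inverse.to bijection x) (Inverse.to bijection y)

-- Refinement carries the membership proof irrelevantly, so its elements are
-- determined by their underlying vertices: it is a genuine subset.
induced : (G : Graph ℓ) → Pred (Vertex G) ℓ → Graph ℓ
induced G S = record
  { Vertex    = Refinement (Vertex G) S
  ; Adj       = Adj G on value
  ; symmetric = symmetric G
  ; loopless  = loopless G ∘ value
  }

EmbedsInto : Graph ℓ → Graph ℓ → Set (suc ℓ)
EmbedsInto {ℓ} G G′ = Σ[ S ∈ Pred (Vertex G′) ℓ ] (G ≅ induced G′ S)

Equimorphic : Graph ℓ → Graph ℓ → Set (suc ℓ)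
Equimorphic G G′ = EmbedsInto G G′ × EmbedsInto G′ G

ExactlyOneSibling : Graph ℓ → Set (suc ℓ)
ExactlyOneSibling {ℓ} G =
  Σ[ S ∈ Graph ℓ ] (Equimorphic S G × (∀ (T : Graph ℓ) → Equimorphic T G → T ≅ S))

IsClique : Graph ℓ → Set ℓ
IsClique G = ∀ x y → x ≢ y → Adj G x y

IsIndependent : Graph ℓ → Set ℓ
IsIndependent G = ∀ x y → ¬ Adj G x y

IsFinite : Graph ℓ → Set ℓ
IsFinite G = ∃[ n ] (Vertex G ↔ Fin n)

module _ (H : Graph ℓ) (L : Vertex H → Graph ℓ) where

  data LexAdj : Rel (Σ (Vertex H) (Vertex ∘ L)) ℓ where
    inside : ∀ {j x y} → Adj (L j) x y → LexAdj (j , x) (j , y)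
    across : ∀ {i j x y} → i ≢ j → Adj H i j → LexAdj (i , x) (j , y)

  private
    lexSymmetric : Symmetric LexAdj
    lexSymmetric (inside {j} a)   = inside (symmetric (L j) a)
    lexSymmetric (across i≢j a) = across (i≢j ∘ sym) (symmetric H a)

    lexLoopless : ∀ p → ¬ LexAdj p p
    lexLoopless (j , x) (inside a)     = loopless (L j) x a
    lexLoopless (j , x) (across j≢j _) = j≢j refl

  lexSum : Graph ℓ
  lexSum = record
    { Vertex    = Σ (Vertex H) (Vertex ∘ L)
    ; Adj       = LexAdj
    ; symmetric = lexSymmetric
    ; loopless  = lexLoopless
    }

-- A disjoint union is only determined up to isomorphism, hence _≅_.
IsFiniteLexSumOfCliquesOrIndependentSets : Graph ℓ → Set (suc ℓ)
IsFiniteLexSumOfCliquesOrIndependentSets {ℓ} G =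
  Σ[ H ∈ Graph ℓ ] Σ[ L ∈ (Vertex H → Graph ℓ) ]
    (IsFinite H × (∀ j → IsClique (L j) ⊎ IsIndependent (L j)) × G ≅ lexSum H L)

{-# OPTIONS --safe #-}
module Submission where

-- Call two vertices twins if no third vertex distinguishes them.  Twinship is an
-- equivalence relation, and embeddings reflect it.  A finite lexicographic sum
-- of cliques and independent sets has finitely many twin classes, so by the
-- pigeonhole principle every self-embedding h has a power h^k, k ≥ 1, sending
-- each vertex to a twin of itself.  Given embeddings f : G′ → G and g : G → G′,
-- apply this to h = f ∘ g: the Cantor–Bernstein bijection built from f and
-- g ∘ h^(k-1) differs from f only by replacing values with twins, and such a
-- change does not affect adjacency.

open import Defs
open import Axiom.ExcludedMiddle using (ExcludedMiddle)
open import Data.Empty using (⊥-elim)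
open import Data.Fin.Base using (Fin; toℕ; funToFin; finToFun)
open import Data.Fin.Properties using (pigeonhole; finToFun-funToFin)
open import Data.Irrelevant using ([_])
open import Data.Nat.Base using (ℕ; zero; suc; _+_; _^_)
open import Data.Nat.GeneralisedArithmetic using (fold; fold-+)
open import Data.Nat.Properties using (+-suc; n<1+n; m≤n⇒∃[o]m+o≡n)
open import Data.Product.Base using (Σ-syntax; ∃-syntax; _×_; _,_; proj₁; proj₂)
open import Data.Refinement using (value; value-injective; _,_)
open import Data.Sum.Base using (_⊎_; inj₁; inj₂)
open import Data.Unit.Polymorphic.Base using (⊤; tt)
open import Function.Base using (_∘_; id)
open import Function.Bundles using (_↔_; _⇔_; Inverse; Injection; mk⇔; mk↔ₛ′)
open import Function.Construct.Composition using () renaming (_⇔-∘_ to infixr 8 _∘⇔_)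
open import Function.Construct.Identity using (⇔-id)
open import Function.Construct.Symmetry using (⇔-sym)
open import Function.Definitions using (Injective)
open import Function.Properties.Inverse using (↔⇒↣)
open import Level using (Level)
open import Relation.Binary.PropositionalEquality using (_≡_; _≢_; refl; sym; trans; cong; subst; module ≡-Reasoning)
open import Relation.Nullary using (¬_; yes; no; contradiction)

private
  variable
    ℓ : Level

-- The Cantor-Bernstein theorem.

module _ (em : ExcludedMiddle ℓ) {A B : Set ℓ} {f : A → B} {g : B → A}
         (f-injective : Injective _≡_ _≡_ f) (g-injective : Injective _≡_ _≡_ g) where

  private
    InImage : A → Set ℓ
    InImage x = ∃[ y ] g y ≡ x

    -- x lies on a chain z, g (f z), g (f (g (f z))), … starting outside the image of g.
    Chain : A → Set ℓ
    Chain x = Σ[ k ∈ ℕ ] Σ[ z ∈ A ] (¬ InImage z × fold z (g ∘ f) k ≡ x)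

    Chain-step : ∀ {x} → Chain x → Chain (g (f x))
    Chain-step (k , z , z∉g , refl) = suc k , z , z∉g , refl

    ¬Chain⇒InImage : ∀ {x} → ¬ Chain x → InImage x
    ¬Chain⇒InImage {x} ¬c with em {InImage x}
    ... | yes x∈g = x∈g
    ... | no  x∉g = contradiction (0 , x , x∉g , refl) ¬c

    -- Kept as a relation, so that both inverse laws follow from uniqueness in each argument,
    -- without evaluating the case distinctions in `match` and `Match-surjective`.
    Match : A → B → Set ℓ
    Match x y = (Chain x × f x ≡ y) ⊎ (¬ Chain x × g y ≡ x)

    match : ∀ x → ∃[ y ] Match x y
    match x with em {Chain x}
    ... | yes c = f x , inj₁ (c , refl)
    ... | no ¬c = let y , gy≡x = ¬Chain⇒InImage ¬c in y , inj₂ (¬c , gy≡x)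

    Match-injective : ∀ {x x′ y} → Match x y → Match x′ y → x ≡ x′
    Match-injective (inj₁ (_ , p))     (inj₁ (_ , q))     = f-injective (trans p (sym q))
    -- The mixed cases cannot occur: one vertex would be the image of the other under `g ∘ f`, and
    -- chains are closed under `g ∘ f`.
    Match-injective (inj₁ (c , refl))  (inj₂ (¬c , refl)) = contradiction (Chain-step c) ¬c
    Match-injective (inj₂ (¬c , refl)) (inj₁ (c , refl))  = contradiction (Chain-step c) ¬c
    Match-injective (inj₂ (_ , p))     (inj₂ (_ , q))     = trans (sym p) q

    Match-functional : ∀ {x y y′} → Match x y → Match x y′ → y ≡ y′
    Match-functional (inj₁ (_ , p))  (inj₁ (_ , q))  = trans (sym p) q
    Match-functional (inj₁ (c , _))  (inj₂ (¬c , _)) = contradiction c ¬c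
    Match-functional (inj₂ (¬c , _)) (inj₁ (c , _))  = contradiction c ¬c
    Match-functional (inj₂ (_ , p))  (inj₂ (_ , q))  = g-injective (trans p (sym q))

    Match-surjective : ∀ y → ∃[ x ] Match x y
    Match-surjective y with em {Chain (g y)}
    ... | no ¬c                        = g y , inj₂ (¬c , refl)
    -- `g y` lies in the image of `g`, so it cannot start its chain; its predecessor there is sent
    -- to `y` by `f`.
    ... | yes (zero  , z , z∉g , z≡gy) = contradiction (y , sym z≡gy) z∉g
    ... | yes (suc k , z , z∉g , p)    = fold z (g ∘ f) k , inj₁ ((k , z , z∉g , refl) , g-injective p)

  -- The second component remembers that each pair comes from `f` or from `g` reversed; this is what
  -- later compares the bijection with `f` up to twins.
  cantorBernstein : Σ[ φ ∈ A ↔ B ] (∀ x → f x ≡ Inverse.to φ x ⊎ g (Inverse.to φ x) ≡ x)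
  cantorBernstein =
    mk↔ₛ′ (proj₁ ∘ match) (proj₁ ∘ Match-surjective)
      (λ y → Match-functional (proj₂ (match _)) (proj₂ (Match-surjective y)))
      (λ x → Match-injective (proj₂ (Match-surjective _)) (proj₂ (match x)))
    , λ x → graph (proj₂ (match x))
    where
    graph : ∀ {x y} → Match x y → f x ≡ y ⊎ g y ≡ x
    graph (inj₁ (_ , p)) = inj₁ p
    graph (inj₂ (_ , p)) = inj₂ p

-- Embeddings as injective maps.

record Embedding (G G′ : Graph ℓ) : Set ℓ where
  field
    to        : Vertex G → Vertex G′
    injective : Injective _≡_ _≡_ to
    adjacency : ∀ x y → Adj G x y ⇔ Adj G′ (to x) (to y)

open Embedding

_∘ᵉ_ : {G G′ G″ : Graph ℓ} → Embedding G′ G″ → Embedding G G′ → Embedding G G″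
f ∘ᵉ g = record
  { to        = to f ∘ to g
  ; injective = injective g ∘ injective f
  ; adjacency = λ x y → adjacency f (to g x) (to g y) ∘⇔ adjacency g x y
  }

iterateᵉ : {G : Graph ℓ} → Embedding G G → ℕ → Embedding G G
iterateᵉ {G = G} h k = record
  { to        = λ x → fold x (to h) k
  ; injective = fold-injective k
  ; adjacency = λ x y → fold-adjacency k
  }
  where
  fold-injective : ∀ k {x y} → fold x (to h) k ≡ fold y (to h) k → x ≡ y
  fold-injective zero    = id
  fold-injective (suc k) = fold-injective k ∘ injective h

  fold-adjacency : ∀ k {x y} → Adj G x y ⇔ Adj G (fold x (to h) k) (fold y (to h) k)
  fold-adjacency zero    = ⇔-id _
  fold-adjacency (suc k) = adjacency h _ _ ∘⇔ fold-adjacency k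

≅⇒Embedding : {G G′ : Graph ℓ} → G ≅ G′ → Embedding G G′
≅⇒Embedding iso = record
  { to        = Inverse.to bijection
  ; injective = Injection.injective (↔⇒↣ bijection)
  ; adjacency = _≅_.adjacency iso
  }
  where open _≅_ iso using (bijection)

induced⇒Embedding : {G : Graph ℓ} {S : Vertex G → Set ℓ} → Embedding (induced G S) G
induced⇒Embedding = record
  { to        = value
  ; injective = value-injective
  ; adjacency = λ _ _ → ⇔-id _
  }

EmbedsInto⇒Embedding : {G G′ : Graph ℓ} → EmbedsInto G G′ → Embedding G G′
EmbedsInto⇒Embedding (_ , iso) = induced⇒Embedding ∘ᵉ ≅⇒Embedding iso

Equimorphic-refl : {G : Graph ℓ} → Equimorphic G G
Equimorphic-refl {G = G} = embeds , embeds
  where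
  embeds : EmbedsInto G G
  embeds = (λ _ → ⊤) , record
    { bijection = mk↔ₛ′ (_, [ tt ]) value (λ _ → refl) (λ _ → refl)
    ; adjacency = λ _ _ → ⇔-id _
    }

-- Twin vertices.

Twin : (G : Graph ℓ) → Vertex G → Vertex G → Set ℓ
Twin G x y = ∀ z → z ≢ x → z ≢ y → Adj G z x ⇔ Adj G z y

Twin-refl : (G : Graph ℓ) → ∀ {x} → Twin G x x
Twin-refl G _ _ _ = ⇔-id _

Twin-sym : (G : Graph ℓ) → ∀ {x y} → Twin G x y → Twin G y x
Twin-sym G t z z≢y z≢x = ⇔-sym (t z z≢x z≢y)

-- By injectivity the image of a third vertex is again a third vertex. Twins need not be preserved,
-- since a vertex outside the image may separate them.
Twin-reflect : {G G′ : Graph ℓ} (f : Embedding G G′) → ∀ {x y} → Twin G′ (to f x) (to f y) → Twin G x y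
Twin-reflect f {x} {y} t z z≢x z≢y =
  ⇔-sym (adjacency f z y) ∘⇔ t (to f z) (z≢x ∘ injective f) (z≢y ∘ injective f) ∘⇔ adjacency f z x

Adj-swap : (G : Graph ℓ) → ∀ {x y} → Adj G x y ⇔ Adj G y x
Adj-swap G = mk⇔ (symmetric G) (symmetric G)

module _ (em : ExcludedMiddle ℓ) (G : Graph ℓ) where

  Twin-trans : ∀ {x y z} → Twin G x y → Twin G y z → Twin G x z
  Twin-trans {x} {y} {z} t u w w≢x w≢z with em {w ≡ y} | em {x ≡ z}
  ... | no w≢y   | _        = u w w≢y w≢z ∘⇔ t w w≢x w≢y
  ... | yes _    | yes refl = ⇔-id _
  -- Neither hypothesis can be tested at the middle vertex `y`. Instead `u` moves the pair `y`, `x`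
  -- to `z`, `x`, and then `t` moves it to `z`, `y`.
  ... | yes refl | no x≢z   =
    Adj-swap G ∘⇔ t z (x≢z ∘ sym) (w≢z ∘ sym) ∘⇔ Adj-swap G ∘⇔ u x (w≢x ∘ sym) x≢z ∘⇔ Adj-swap G

  Twin-adjacency : ∀ {x x′ y y′} → Twin G x x′ → Twin G y y′ → x ≢ y → x′ ≢ y′ → Adj G x y ⇔ Adj G x′ y′
  Twin-adjacency {x} {x′} {y} {y′} t u x≢y x′≢y′ with em {x ≡ y′}
  -- The ends change one at a time, via the pair `x`, `y′`. If that pair collapses, then `y`, `x`
  -- and `x′` are all twins, and one move with `x` fixed suffices.
  ... | no x≢y′  = Adj-swap G ∘⇔ t y′ (x≢y′ ∘ sym) (x′≢y′ ∘ sym) ∘⇔ Adj-swap G ∘⇔ u x x≢y x≢y′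
  ... | yes refl = Adj-swap G ∘⇔ Twin-trans u t x x≢y (x′≢y′ ∘ sym)

  -- Powers of a self-embedding that fix every twin class.

  TwinIdentity : Embedding G G → Set ℓ
  TwinIdentity e = ∀ x → Twin G (to e x) x

  -- As twins are only reflected, the representative `r` is chosen for `e x` and not for `x`: both
  -- `e x` and `e r` are twins of `r`, so `x` is a twin of `r`, hence of `e x`.
  twinIdentity-fromReps : (e : Embedding G G) →
    (∀ x → ∃[ r ] (Twin G x r × Twin G (to e r) r)) → TwinIdentity e
  twinIdentity-fromReps e rep x =
    let r , ex~r , er~r = rep (to e x)
        x~r = Twin-reflect e (Twin-trans ex~r (Twin-sym G er~r))
    in Twin-trans ex~r (Twin-sym G x~r)

  module _ {n : ℕ} (class : Vertex G → Fin n)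
           (class⇒Twin : ∀ {x y} → class x ≡ class y → Twin G x y)
           (h : Embedding G G) where

    simultaneousReturn : ∀ {m} (r : Fin m → Vertex G) →
      ∃[ k ] (∀ i → Twin G (to (iterateᵉ h (suc k)) (r i)) (r i))
    -- The pigeons are the exponents from 0 to `n ^ m`, the holes are the `n ^ m` tuples of classes.
    -- Using whole tuples gives one exponent that serves all `i`.
    simultaneousReturn {m} r with pigeonhole (n<1+n (n ^ m)) (λ p → funToFin (classes (toℕ p)))
      where
      classes : ℕ → Fin m → Fin n
      classes p i = class (to (iterateᵉ h p) (r i))
    ... | p , q , p<q , same with m≤n⇒∃[o]m+o≡n p<q
    -- The return exponent is the difference of `q` and `p`, namely `suc k`; reflecting along the
    -- `p`-th power cancels the common part.
    ... | k , p+k≡q = k , λ i → Twin-sym G (Twin-reflect (iterateᵉ h (toℕ p)) (class⇒Twin (returns i)))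
      where
      open ≡-Reasoning
      returns : ∀ i → class (fold (r i) (to h) (toℕ p)) ≡
                      class (fold (fold (r i) (to h) (suc k)) (to h) (toℕ p))
      returns i = begin
        class (fold (r i) (to h) (toℕ p))                               ≡⟨ finToFun-funToFin _ i ⟨
        finToFun (funToFin λ j → class (fold (r j) (to h) (toℕ p))) i   ≡⟨ cong (λ c → finToFun c i) same ⟩
        finToFun (funToFin λ j → class (fold (r j) (to h) (toℕ q))) i   ≡⟨ finToFun-funToFin _ i ⟩
        class (fold (r i) (to h) (toℕ q))                               ≡⟨ cong (class ∘ fold (r i) (to h)) (trans (+-suc (toℕ p) k) p+k≡q) ⟨
        class (fold (r i) (to h) (toℕ p + suc k))                       ≡⟨ cong class (fold-+ (r i) (to h) (toℕ p)) ⟩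
        class (fold (fold (r i) (to h) (suc k)) (to h) (toℕ p))         ∎

    twinIdentityPower : ∃[ k ] TwinIdentity (iterateᵉ h (suc k))
    twinIdentityPower with em {Vertex G}
    ... | no  empty = 0 , λ x → contradiction x empty
    ... | yes x₀    =
      let k , back = simultaneousReturn rep
      in k , twinIdentity-fromReps (iterateᵉ h (suc k))
               (λ x → rep (class x) , class⇒Twin (sym (class-rep x)) , back (class x))
      where
      -- Indices of empty classes get the junk representative x₀.
      rep : Fin n → Vertex G
      rep i with em {∃[ x ] class x ≡ i}
      ... | yes (x , _) = x
      ... | no _        = x₀

      class-rep : ∀ x → class (rep (class x)) ≡ class x
      class-rep x with em {∃[ y ] class y ≡ class x}
      ... | yes (_ , eq) = eq
      ... | no none      = contradiction (x , refl) none

  -- From twin-preserving round trips to isomorphism.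

  twinIdentity⇒≅ : {G′ : Graph ℓ} (f : Embedding G′ G) (g : Embedding G G′) →
    TwinIdentity (f ∘ᵉ g) → G′ ≅ G
  twinIdentity⇒≅ {G′} f g fg~id
    with cantorBernstein em (injective f) (injective g)
  ... | φ , near = record { bijection = φ ; adjacency = φ-adjacency }
    where
    φ-twin : ∀ x → Twin G (to f x) (Inverse.to φ x)
    φ-twin x with near x
    ... | inj₁ fx≡φx = subst (Twin G (to f x)) fx≡φx (Twin-refl G)
    -- Here `f x` is `f (g (φ x))`, a twin of `φ x` by hypothesis.
    ... | inj₂ gφx≡x = subst (λ y → Twin G (to f y) (Inverse.to φ x)) gφx≡x (fg~id (Inverse.to φ x))

    φ-adjacency : ∀ x y → Adj G′ x y ⇔ Adj G (Inverse.to φ x) (Inverse.to φ y)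
    φ-adjacency x y with em {x ≡ y}
    ... | yes refl = mk⇔ (⊥-elim ∘ loopless G′ x) (⊥-elim ∘ loopless G _)
    ... | no x≢y   =
      Twin-adjacency (φ-twin x) (φ-twin y) (x≢y ∘ injective f) (x≢y ∘ Injection.injective (↔⇒↣ φ))
      ∘⇔ adjacency f x y

module _ (H : Graph ℓ) (L : Vertex H → Graph ℓ) where

  -- A vertex of another block sees all of block `j` alike. A third vertex inside block `j` is
  -- adjacent to both vertices in a clique, to neither in an independent set.
  lexSum-twin : ∀ {j} → IsClique (L j) ⊎ IsIndependent (L j) →
    ∀ x y → Twin (lexSum H L) (j , x) (j , y)
  lexSum-twin {j} homogeneous x y z z≢x z≢y = mk⇔ (move homogeneous z≢y) (move homogeneous z≢x)
    where
    move : IsClique (L j) ⊎ IsIndependent (L j) → ∀ {z x y} → z ≢ (j , y) →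
           LexAdj H L z (j , x) → LexAdj H L z (j , y)
    move (inj₁ clique)      z≢y (inside _)     = inside (clique _ _ (z≢y ∘ cong (j ,_)))
    move (inj₂ independent) z≢y (inside a)     = ⊥-elim (independent _ _ a)
    move _                  z≢y (across i≢j a) = across i≢j a

theorem4p1 : (ℓ : Level) → ExcludedMiddle ℓ →
    (G : Graph ℓ) → IsFiniteLexSumOfCliquesOrIndependentSets G →
    (∀ (G′ : Graph ℓ) → Equimorphic G′ G → G′ ≅ G) × ExactlyOneSibling G
theorem4p1 ℓ em G (H , L , (n , index) , homogeneous , iso) =
  sibling≅ , G , Equimorphic-refl , sibling≅
  where
  ι : Embedding G (lexSum H L)
  ι = ≅⇒Embedding iso

  class : Vertex G → Fin n
  class = Inverse.to index ∘ proj₁ ∘ to ι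

  block⇒Twin : ∀ {p q} → proj₁ p ≡ proj₁ q → Twin (lexSum H L) p q
  block⇒Twin refl = lexSum-twin H L (homogeneous _) _ _

  class⇒Twin : ∀ {x y} → class x ≡ class y → Twin G x y
  class⇒Twin eq = Twin-reflect ι (block⇒Twin (Injection.injective (↔⇒↣ index) eq))

  sibling≅ : ∀ G′ → Equimorphic G′ G → G′ ≅ G
  sibling≅ G′ (G′↪G , G↪G′) =
    let f = EmbedsInto⇒Embedding G′↪G
        g = EmbedsInto⇒Embedding G↪G′
        k , h^k~id = twinIdentityPower em G class class⇒Twin (f ∘ᵉ g)
    -- Since the exponent `suc k` is positive, one factor `f ∘ᵉ g` splits off; the power is then, by
    -- computation, `f` after the embedding supplied here.
    in twinIdentity⇒≅ em G f (g ∘ᵉ iterateᵉ (f ∘ᵉ g) k) h^k~id
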